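{- Let $b\ge 1$ be an integer such that there exists a Hadamard matrix of order $4b$. Then for all integers $\alpha, k$ with $\alpha\geq 2$ and $2^{\alpha}+\alpha+1\leq k<2^{\alpha}b-\alpha$ there exists an array of type $I_{k+\alpha}(2^{\alpha}b,2^k,2,2)$.
   Context: For an integer $s\ge 1$ let $[s]=\{0,1,\dots,s-1\}$. An orthogonal array OA$(n,k,q,t)$ (size $n$, degree $k$, $q$ levels, strength $t$, $1\le t\leq k$) is an $n\times k$ array with entries from $[q]$ such that in every $n\times t$ submatrix (choice of $t$ columns), every vector of $[q]^t$ appears as a row exactly $n/q^t$ times. An array of type $I_k(m,n,q,t)$ (an $m\times n$ row-column factorial design $q^k$ of strength $t$) is an $m\times n$ array whose cells each contain a vector of $[q]^k$ such that: (i) each vector of $[q]^k$ occurs in exactly $\lambda=mn/q^k$ cells (so $q^k\mid mn$); (ii) for each row of the array, the $n$ vectors in that row are the rows of an OA$(n,k,q,t)$; (iii) for each column of the array, the $m$ vectors in that column are the rows of an OA$(m,k,q,t)$. A Hadamard matrix of order $n$ is an $n\times n$ matrix $H$ with entries in $\{1,-1\}$ and $HH^T=nI_n$. -}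

module Defs where

open import Algebra.Properties.Semiring.Sum using (sum-syntax)
open import Data.Bool using (if_then_else_)
open import Data.Fin using (Fin; _<_)
import Data.Fin.Properties as Fin
open import Data.Integer as ℤ using (ℤ; 0ℤ; 1ℤ; -1ℤ)
open import Data.Integer.Properties using (+-*-semiring)
open import Data.Nat using (ℕ; _≤_; _*_; _^_)
open import Data.Nat.Divisibility using (_∣_; quotient)
open import Data.Sum using (_⊎_)
open import Data.Vec as Vec using (Vec)
open import Data.Vec.Functional as Vector using (Vector)
open import Data.Vec.Properties using (≡-dec)
open import Relation.Binary.Definitions using (Monotonic₁)
open import Relation.Binary.PropositionalEquality using (_≡_)
open import Relation.Nullary.Decidable using (does)

Matrix : Set → ℕ → ℕ → Set
Matrix A m n = Vector (Vector A n) m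

_⊡_ : ∀ {l m n} → Matrix ℤ l m → Matrix ℤ m n → Matrix ℤ l n
_⊡_ {m = m} M N i j = sum-syntax +-*-semiring m λ x → M i x ℤ.* N x j

identity : ∀ n → Matrix ℤ n n
identity n i j = if does (i Fin.≟ j) then 1ℤ else 0ℤ

record IsHadamard (n : ℕ) (H : Matrix ℤ n n) : Set where
  field
    entries    : ∀ i j → H i j ≡ 1ℤ ⊎ H i j ≡ -1ℤ
    orthogonal : ∀ i j → (H ⊡ Vector.transpose H) i j ≡ ℤ.+ n ℤ.* identity n i j

occurrences : ∀ {q k n} → Vec (Fin q) k → Vector (Vec (Fin q) k) n → ℕ
occurrences {n = n} v xs = Vec.count (λ i → ≡-dec Fin._≟_ v (xs i)) (Vec.allFin n)

select : ∀ {q k t} → (Fin t → Fin k) → Vec (Fin q) k → Vec (Fin q) t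
select c v = Vec.tabulate λ j → Vec.lookup v (c j)

-- A choice of t of the k columns is a strictly increasing map Fin t → Fin k.
-- The frequency n / q ^ t is the quotient of a divisibility proof, so it is
-- an exact quotient rather than a rounded one.
record IsOA (n k q t : ℕ) (rows : Vector (Vec (Fin q) k) n) : Set where
  field
    1≤q     : 1 ≤ q
    1≤t     : 1 ≤ t
    t≤k     : t ≤ k
    q^t∣n   : q ^ t ∣ n
    uniform : (c : Fin t → Fin k) → Monotonic₁ _<_ _<_ c → (v : Vec (Fin q) t) →
              occurrences v (Vector.map (select c) rows) ≡ quotient q^t∣n

record IsTypeI (k m n q t : ℕ) (A : Matrix (Vec (Fin q) k) m n) : Set where
  field
    q^k∣mn     : q ^ k ∣ m * n
    replicated : (v : Vec (Fin q) k) → occurrences v (Vector.concat A) ≡ quotient q^k∣mn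
    rowOA      : (i : Fin m) → IsOA n k q t (A i)
    columnOA   : (j : Fin n) → IsOA m k q t (Vector.transpose A j)

-- A Hadamard matrix of order 4b gives, by Sylvester doubling, an orthogonal
-- array of strength 2 with 2^α b runs and k + α factors. Sorting the runs makes
-- the last α factors jointly uniform: the runs are indexed by (s , β) with
-- s ∈ F₂^α, β < b, and run (s , β) is (u(s , β) , s) for some u(s , β) ∈ F₂^k.
-- Let τ : F₂^k → F₂^α be linear and onto with a kernel of strength 2 (τ adds up
-- α disjoint triples of positions, and 3α ≤ k). The cell in row (s , β) and
-- column j is (u(s + τ j , β) + j , s + τ j).
--
-- A column permutes the runs and adds a constant, so it stays an orthogonal
-- array. In a row, the translations j ↦ j + v with v ∈ ker τ or τ v a unit vector
-- reverse the sign of every character of weight 1 or 2, so these characters sum to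
-- zero. Finally a cell and β determine s + τ j, hence u(s + τ j , β), j and s, so
-- each vector occurs exactly b times.

module Submission where

open import Defs
open import Algebra.Bundles using (CommutativeMonoid; CommutativeSemigroup)
import Algebra.Properties.CommutativeMonoid.Sum as CommutativeMonoidSum
import Algebra.Properties.CommutativeSemigroup as CommutativeSemigroupProperties
import Algebra.Properties.Semiring.Sum as SemiringSum
open import Data.Bool using (if_then_else_)
open import Data.Fin as Fin using (Fin; zero; suc; _↑ˡ_; _↑ʳ_; combine; opposite; punchIn; splitAt)
open import Data.Fin.Patterns using (0F; 1F; 2F)
open import Data.Fin.Permutation using (Permutation; _⟨$⟩ʳ_; insert; insert-punchIn)
import Data.Fin.Properties as Fin
open import Data.Integer as ℤ using (ℤ; 0ℤ; 1ℤ; -1ℤ)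
import Data.Integer.Properties as ℤ
open import Data.Nat using (ℕ; zero; suc; _+_; _*_; _∸_; _^_; _≤_; _<_; z≤n; s≤s)
open import Data.Nat.Divisibility using (_∣_; divides; quotient; ∣m⇒∣m*n)
import Data.Nat.Properties as ℕ
open import Data.Product using (Σ; ∃; ∃₂; _×_; _,_; proj₁; proj₂; uncurry)
open import Data.Product.Function.NonDependent.Propositional using (_×-↔_)
open import Data.Sum using (_⊎_; inj₁; inj₂)
open import Data.Vec as Vec using (Vec; []; _∷_; _++_; lookup; tabulate; replicate; zipWith; take; drop; _[_]≔_)
open import Data.Vec.Functional as Vector using (Vector)
import Data.Vec.Properties as Vec
open import Function using (_∘_; Injective; _↔_; Inverse; mk↔ₛ′)
open import Function.Construct.Composition using (_↔-∘_)
open import Function.Construct.Identity using (↔-id)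
open import Function.Construct.Symmetry using (↔-sym)
open import Level using (0ℓ)
open import Relation.Binary.Definitions using (DecidableEquality)
open import Relation.Binary.PropositionalEquality hiding ([_])
open import Relation.Nullary.Decidable using (Dec; yes; no; does; ¬?)
open import Relation.Nullary.Negation using (¬_; contradiction)
open import Relation.Unary using (Pred; Decidable)

open Inverse using (to; from)

-- Bijections and enumerations.

to-from : ∀ {A B : Set} (e : A ↔ B) y → to e (from e y) ≡ y
to-from e y = Inverse.inverseˡ e refl

from-to : ∀ {A B : Set} (e : A ↔ B) x → from e (to e x) ≡ x
from-to e x = Inverse.inverseʳ e refl

×-enum : ∀ {m n} {A B : Set} → Fin m ↔ A → Fin n ↔ B → Fin (m * n) ↔ (A × B)
×-enum e e′ = (e ×-↔ e′) ↔-∘ Fin.*↔×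

∷-↔ : ∀ {A : Set} {n} → (A × Vec A n) ↔ Vec A (suc n)
∷-↔ = mk↔ₛ′ (uncurry _∷_) (λ v → Vec.head v , Vec.tail v) (λ { (x ∷ v) → refl }) (λ _ → refl)

++-↔ : ∀ {A : Set} m {n} → (Vec A m × Vec A n) ↔ Vec A (m + n)
++-↔ m = mk↔ₛ′ (uncurry _++_) (λ v → take m v , drop m v) (Vec.take++drop≡id m)
  λ { (v , w) → cong₂ _,_ (Vec.++-injectiveˡ _ v (Vec.take++drop≡id m (v ++ w)))
                          (Vec.++-injectiveʳ _ v (Vec.take++drop≡id m (v ++ w))) }

vecEnum : ∀ {q} k → Fin (q ^ k) ↔ Vec (Fin q) k
vecEnum zero    = mk↔ₛ′ (λ _ → []) (λ _ → zero) (λ { [] → refl }) (λ { zero → refl })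
vecEnum (suc k) = ∷-↔ ↔-∘ ×-enum (↔-id _) (vecEnum k)

-- Sums over enumerated types

module SumOver (M : CommutativeMonoid 0ℓ 0ℓ) where
  open CommutativeMonoid M using (Carrier; _≈_; _∙_; ∙-cong; identityˡ; assoc; reflexive)
    renaming (refl to ≈-refl; sym to ≈-sym; trans to ≈-trans)
  open CommutativeMonoidSum M

  sumOver : ∀ {n} {A : Set} → Fin n ↔ A → (A → Carrier) → Carrier
  sumOver e f = sum (f ∘ to e)

  sumOver-cong : ∀ {n} {A : Set} (e : Fin n ↔ A) {f g : A → Carrier} →
                 (∀ x → f x ≈ g x) → sumOver e f ≈ sumOver e g
  sumOver-cong e f≈g = sum-cong-≋ (f≈g ∘ to e)

  -- The composite of `c` with both enumerations is a permutation of indices. Changes of summation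
  -- variable such as translating, sorting or splitting off a bit all go through this.
  sumOver-reindex : ∀ {m n} {A B : Set} (e : Fin m ↔ A) (e′ : Fin n ↔ B) (c : A ↔ B) (f : B → Carrier) →
                    sumOver e (f ∘ to c) ≈ sumOver e′ f
  sumOver-reindex e e′ c f =
    ≈-trans (sum-cong-≋ {x = f ∘ to c ∘ to e} λ i → reflexive (cong f (sym (to-from e′ (to c (to e i))))))
            (≈-sym (sum-permute (f ∘ to e′) (↔-sym e′ ↔-∘ (c ↔-∘ e))))

  sum-+ : ∀ m {n} (f : Vector Carrier (m + n)) → sum f ≈ sum (f ∘ (_↑ˡ n)) ∙ sum (f ∘ (m ↑ʳ_))
  sum-+ zero    f = ≈-sym (identityˡ _)
  sum-+ (suc m) f = ≈-trans (∙-cong ≈-refl (sum-+ m (f ∘ suc))) (≈-sym (assoc _ _ _))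

  sum-combine : ∀ m {n} (f : Vector Carrier (m * n)) →
                sum f ≈ sum (λ i → sum (λ j → f (combine {m} i j)))
  sum-combine zero    f = ≈-refl
  sum-combine (suc m) {n} f = ≈-trans (sum-+ n f) (∙-cong ≈-refl (sum-combine m (f ∘ (n ↑ʳ_))))

  sumOver-× : ∀ {m n} {A B : Set} (e : Fin m ↔ A) (e′ : Fin n ↔ B) (f : A × B → Carrier) →
              sumOver (×-enum e e′) f ≈ sumOver e λ x → sumOver e′ λ y → f (x , y)
  sumOver-× {m} {n} e e′ f = ≈-trans (sum-combine m _)
    (sum-cong-≋ λ i → sum-cong-≋ λ j → reflexive
      (cong (λ (a , b) → f (to e a , to e′ b)) (Fin.remQuot-combine {m} {n} i j)))

module ℕ∑ where
  open CommutativeMonoidSum ℕ.+-0-commutativeMonoid public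
  open SumOver ℕ.+-0-commutativeMonoid public

module ℤ∑ where
  open SemiringSum ℤ.+-*-semiring public
  open SumOver ℤ.+-0-commutativeMonoid public

∑-const-1 : ∀ n → ℕ∑.sum {n} (λ _ → 1) ≡ n
∑-const-1 zero    = refl
∑-const-1 (suc n) = cong suc (∑-const-1 n)

+-∑ : ∀ {n} (f : Vector ℕ n) → ℤ.+ ℕ∑.sum f ≡ ℤ∑.sum (λ i → ℤ.+ f i)
+-∑ {zero}  f = refl
+-∑ {suc n} f = cong (ℤ._+_ (ℤ.+ f zero)) (+-∑ (f ∘ suc))

-- Counting occurrences

[_] : ∀ {P : Set} → Dec P → ℕ
[ P? ] = if does P? then 1 else 0

[]-yes : ∀ {P : Set} (P? : Dec P) → P → [ P? ] ≡ 1
[]-yes (yes _) _ = refl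
[]-yes (no ¬p) p = contradiction p ¬p

[]-no : ∀ {P : Set} (P? : Dec P) → ¬ P → [ P? ] ≡ 0
[]-no (yes p) ¬p = contradiction p ¬p
[]-no (no _)  _  = refl

count-tabulate : ∀ {A : Set} {P : Pred A 0ℓ} (P? : Decidable P) {n} (f : Vector A n) →
                 Vec.count P? (tabulate f) ≡ ℕ∑.sum (λ i → [ P? (f i) ])
count-tabulate P? {zero}  f = refl
count-tabulate P? {suc n} f with P? (f zero)
... | yes _ = cong suc (count-tabulate P? (f ∘ suc))
... | no _  = count-tabulate P? (f ∘ suc)

infix 4 _≟ᵥ_
_≟ᵥ_ : ∀ {q k} → DecidableEquality (Vec (Fin q) k)
_≟ᵥ_ = Vec.≡-dec Fin._≟_

occurrences-∑ : ∀ {q k n} (v : Vec (Fin q) k) (xs : Vector (Vec (Fin q) k) n) →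
                occurrences v xs ≡ ℕ∑.sum (λ i → [ v ≟ᵥ xs i ])
occurrences-∑ v xs = count-tabulate (λ i → v ≟ᵥ xs i) (λ i → i)

∑-indicator-zero : ∀ {n} {P : Pred (Fin n) 0ℓ} (P? : Decidable P) → (∀ i → ¬ P i) → ℕ∑.sum (λ i → [ P? i ]) ≡ 0
∑-indicator-zero {zero}  P? ¬P = refl
∑-indicator-zero {suc n} P? ¬P = cong₂ _+_ ([]-no (P? zero) (¬P zero)) (∑-indicator-zero (P? ∘ suc) (¬P ∘ suc))

∑-δ : ∀ {n} (x : Fin n) → ℕ∑.sum (λ y → [ x Fin.≟ y ]) ≡ 1
∑-δ {suc n} x = trans (ℕ∑.sum-remove {i = x} (λ y → [ x Fin.≟ y ])) (cong₂ _+_ ([]-yes (x Fin.≟ x) refl)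
  (∑-indicator-zero (λ y → x Fin.≟ punchIn x y) λ y eq → Fin.punchInᵢ≢i x y (sym eq)))

module _ {V : Set} (_≟_ : DecidableEquality V) where

  sumOver-δ : ∀ {n} (e : Fin n ↔ V) v → ℕ∑.sumOver e (λ w → [ v ≟ w ]) ≡ 1
  sumOver-δ e v = trans (ℕ∑.sum-cong-≗ same) (∑-δ (from e v))
    where
    same : ∀ i → [ v ≟ to e i ] ≡ [ from e v Fin.≟ i ]
    same i with from e v Fin.≟ i
    ... | yes refl = []-yes (v ≟ _) (sym (to-from e v))
    ... | no ne    = []-no (v ≟ _) λ { refl → ne (from-to e i) }

  -- The bijection `c` turns `f` into the first projection, so each fibre of `f` is a copy of
  -- `Fin b`.
  count-fibres : ∀ {m n b} {A : Set} (eV : Fin m ↔ V) (eA : Fin n ↔ A) (c : (V × Fin b) ↔ A) (f : A → V) →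
                 (∀ x → f (to c x) ≡ proj₁ x) → ∀ v → ℕ∑.sumOver eA (λ a → [ v ≟ f a ]) ≡ b
  count-fibres {b = b} eV eA c f f∘c v = begin
    ℕ∑.sumOver eA (λ a → [ v ≟ f a ])
      -- The factors are swapped so that the inner sum runs over `V`, where the indicator
      -- contributes exactly 1 for each `β`.
      ≡⟨ ℕ∑.sumOver-reindex (×-enum (↔-id _) eV) eA (c ↔-∘ swap) (λ a → [ v ≟ f a ]) ⟨
    ℕ∑.sumOver (×-enum (↔-id (Fin b)) eV) (λ (β , w) → [ v ≟ f (to c (w , β)) ])
      ≡⟨ ℕ∑.sumOver-× (↔-id (Fin b)) eV (λ (β , w) → [ v ≟ f (to c (w , β)) ]) ⟩
    ℕ∑.sum (λ β → ℕ∑.sumOver eV (λ w → [ v ≟ f (to c (w , β)) ]))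
      ≡⟨ ℕ∑.sum-cong-≗ (λ β → trans (ℕ∑.sumOver-cong eV λ w → cong (λ z → [ v ≟ z ]) (f∘c (w , β))) (sumOver-δ eV v)) ⟩
    ℕ∑.sum {b} (λ _ → 1)
      ≡⟨ ∑-const-1 b ⟩
    b ∎
    where
    open ≡-Reasoning
    swap : ∀ {A B : Set} → (A × B) ↔ (B × A)
    swap = mk↔ₛ′ (λ (a , b) → b , a) (λ (b , a) → a , b) (λ _ → refl) (λ _ → refl)

  -- Induction: match `g zero` with an equal `f i`, delete both and continue. This is what sorts the
  -- columns of the Hadamard matrix.
  same-counts⇒permutation : ∀ {n} (f g : Vector V n) →
    (∀ v → ℕ∑.sum (λ i → [ v ≟ f i ]) ≡ ℕ∑.sum (λ i → [ v ≟ g i ])) →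
    Σ (Permutation n n) λ π → ∀ i → f (π ⟨$⟩ʳ i) ≡ g i
  same-counts⇒permutation {zero}  f g _  = ↔-id _ , λ ()
  same-counts⇒permutation {suc n} f g eq with Fin.any? (λ i → g zero ≟ f i)
  -- Without a match, the value `g zero` would have count 0 under `f` but at least 1 under `g`.
  ... | no g₀∉f = contradiction
    (trans (sym (trans (eq (g zero)) (cong (_+ ℕ∑.sum (λ i → [ g zero ≟ g (suc i) ])) ([]-yes (g zero ≟ g zero) refl))))
           (∑-indicator-zero (λ i → g zero ≟ f i) (λ i p → g₀∉f (i , p))))
    λ ()
  ... | yes (i , g₀≡fᵢ) with same-counts⇒permutation (f ∘ punchIn i) (g ∘ suc) (λ v →
          -- The deleted entries are equal, so their indicator cancels from both counts.
          ℕ.+-cancelˡ-≡ [ v ≟ g zero ] _ _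
            (trans (cong (λ z → [ v ≟ z ] + _) g₀≡fᵢ)
              (trans (sym (ℕ∑.sum-remove {i = i} (λ j → [ v ≟ f j ]))) (eq v))))
  ... | π , fπ≡g = insert zero i π , λ
    { zero    → sym g₀≡fᵢ
    ; (suc j) → trans (cong f (insert-punchIn zero i π j)) (fπ≡g j) }

-- The field of two elements and its characters

infixl 6 _⊕_ _⊞_
infixl 7 _⊙_

_⊕_ : Fin 2 → Fin 2 → Fin 2
0F ⊕ y = y
1F ⊕ y = opposite y

_⊙_ : Fin 2 → Fin 2 → Fin 2
0F ⊙ y = 0F
1F ⊙ y = y

⊕-assoc : ∀ x y z → (x ⊕ y) ⊕ z ≡ x ⊕ (y ⊕ z)
⊕-assoc 0F y  z  = refl
⊕-assoc 1F 0F z  = refl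
⊕-assoc 1F 1F 0F = refl
⊕-assoc 1F 1F 1F = refl

⊕-comm : ∀ x y → x ⊕ y ≡ y ⊕ x
⊕-comm 0F 0F = refl
⊕-comm 0F 1F = refl
⊕-comm 1F 0F = refl
⊕-comm 1F 1F = refl

⊕-identityʳ : ∀ x → x ⊕ 0F ≡ x
⊕-identityʳ x = ⊕-comm x 0F

⊕-self : ∀ x → x ⊕ x ≡ 0F
⊕-self 0F = refl
⊕-self 1F = refl

⊕-cancelʳ : ∀ x y → (x ⊕ y) ⊕ y ≡ x
⊕-cancelʳ x y = trans (⊕-assoc x y y) (trans (cong (x ⊕_) (⊕-self y)) (⊕-identityʳ x))

⊕-commutativeSemigroup : CommutativeSemigroup 0ℓ 0ℓ
⊕-commutativeSemigroup = record
  { isCommutativeSemigroup = record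
    { isSemigroup = record
      { isMagma = record { isEquivalence = isEquivalence ; ∙-cong = cong₂ _⊕_ }
      ; assoc   = ⊕-assoc }
    ; comm = ⊕-comm } }

open CommutativeSemigroupProperties ⊕-commutativeSemigroup using () renaming (interchange to ⊕-interchange)

_⊞_ : ∀ {n} → Vec (Fin 2) n → Vec (Fin 2) n → Vec (Fin 2) n
_⊞_ = zipWith _⊕_

𝟎 : ∀ {n} → Vec (Fin 2) n
𝟎 = replicate _ 0F

lookup-⊞ : ∀ {n} p (v w : Vec (Fin 2) n) → lookup (v ⊞ w) p ≡ lookup v p ⊕ lookup w p
lookup-⊞ = Vec.lookup-zipWith _⊕_

lookup-𝟎 : ∀ {n} (p : Fin n) → lookup 𝟎 p ≡ 0F
lookup-𝟎 p = Vec.lookup-replicate p 0F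

⊞-identityʳ : ∀ {n} (v : Vec (Fin 2) n) → v ⊞ 𝟎 ≡ v
⊞-identityʳ = Vec.zipWith-identityʳ ⊕-identityʳ

⊞-comm : ∀ {n} (v w : Vec (Fin 2) n) → v ⊞ w ≡ w ⊞ v
⊞-comm = Vec.zipWith-comm ⊕-comm

⊞-assoc : ∀ {n} (u v w : Vec (Fin 2) n) → (u ⊞ v) ⊞ w ≡ u ⊞ (v ⊞ w)
⊞-assoc = Vec.zipWith-assoc ⊕-assoc

⊞-cancelʳ : ∀ {n} (v w : Vec (Fin 2) n) → (v ⊞ w) ⊞ w ≡ v
⊞-cancelʳ []      []      = refl
⊞-cancelʳ (x ∷ v) (y ∷ w) = cong₂ _∷_ (⊕-cancelʳ x y) (⊞-cancelʳ v w)

⊞-cancelˡ : ∀ {n} (v w : Vec (Fin 2) n) → v ⊞ (v ⊞ w) ≡ w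
⊞-cancelˡ v w = trans (⊞-comm v (v ⊞ w)) (trans (cong (_⊞ v) (⊞-comm v w)) (⊞-cancelʳ w v))

⊞-↔ : ∀ {n} → Vec (Fin 2) n → Vec (Fin 2) n ↔ Vec (Fin 2) n
⊞-↔ v = mk↔ₛ′ (_⊞ v) (_⊞ v) (λ w → ⊞-cancelʳ w v) (λ w → ⊞-cancelʳ w v)

unit : ∀ {n} → Fin n → Vec (Fin 2) n
unit p = 𝟎 [ p ]≔ 1F

lookup-unit : ∀ {n} (p : Fin n) → lookup (unit p) p ≡ 1F
lookup-unit p = Vec.lookup∘update p 𝟎 1F

lookup-unit-≢ : ∀ {n} {p q : Fin n} → q ≢ p → lookup (unit p) q ≡ 0F
lookup-unit-≢ {q = q} q≢p = trans (Vec.lookup∘update′ q≢p 𝟎 1F) (lookup-𝟎 q)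

sgn : Fin 2 → ℤ
sgn 0F = 1ℤ
sgn 1F = -1ℤ

sgn-⊕ : ∀ x y → sgn (x ⊕ y) ≡ sgn x ℤ.* sgn y
sgn-⊕ 0F 0F = refl
sgn-⊕ 0F 1F = refl
sgn-⊕ 1F 0F = refl
sgn-⊕ 1F 1F = refl

-- Balanced functions and arrays of strength 2.

i≡-i⇒i≡0 : ∀ {i : ℤ} → i ≡ ℤ.- i → i ≡ 0ℤ
-- For a nonzero `i` the two sides have different constructors.
i≡-i⇒i≡0 {ℤ.+ zero} _ = refl

-- Equivalently, `f` takes the values `0F` and `1F` equally often.
Balanced : ∀ {n} {A : Set} → Fin n ↔ A → (A → Fin 2) → Set
Balanced e f = ℤ∑.sumOver e (sgn ∘ f) ≡ 0ℤ

module _ {n} {A : Set} (e : Fin n ↔ A) where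

  balanced-cong : ∀ {f g} → (∀ x → f x ≡ g x) → Balanced e f → Balanced e g
  balanced-cong f≡g bal = trans (ℤ∑.sumOver-cong e λ x → cong sgn (sym (f≡g x))) bal

  balanced-⊕ : ∀ f c → Balanced e f → Balanced e (λ x → f x ⊕ c)
  balanced-⊕ f c bal = begin
    ℤ∑.sumOver e (λ x → sgn (f x ⊕ c))      ≡⟨ ℤ∑.sumOver-cong e (λ x → sgn-⊕ (f x) c) ⟩
    ℤ∑.sumOver e (λ x → sgn (f x) ℤ.* sgn c) ≡⟨ ℤ∑.*-distribʳ-sum (sgn c) (sgn ∘ f ∘ to e) ⟨
    ℤ∑.sumOver e (sgn ∘ f) ℤ.* sgn c         ≡⟨ cong (ℤ._* sgn c) bal ⟩
    0ℤ                                       ∎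
    where open ≡-Reasoning

  balanced-reindex : ∀ f (θ : A ↔ A) → Balanced e f → Balanced e (f ∘ to θ)
  balanced-reindex f θ bal = trans (ℤ∑.sumOver-reindex e e θ (sgn ∘ f)) bal

  -- Reindexing by `θ` preserves the sum while the flip negates it, so the sum equals its own
  -- negative.
  balanced-flip : ∀ f (θ : A ↔ A) → (∀ x → f (to θ x) ≡ f x ⊕ 1F) → Balanced e f
  balanced-flip f θ flip = i≡-i⇒i≡0 (begin
    ℤ∑.sumOver e (sgn ∘ f)                  ≡⟨ ℤ∑.sumOver-reindex e e θ (sgn ∘ f) ⟨
    ℤ∑.sumOver e (sgn ∘ f ∘ to θ)           ≡⟨ ℤ∑.sumOver-cong e (λ x → trans (cong sgn (flip x)) (sgn-⊕ (f x) 1F)) ⟩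
    ℤ∑.sumOver e (λ x → sgn (f x) ℤ.* -1ℤ)  ≡⟨ ℤ∑.*-distribʳ-sum -1ℤ (sgn ∘ f ∘ to e) ⟨
    ℤ∑.sumOver e (sgn ∘ f) ℤ.* -1ℤ          ≡⟨ ℤ.*-comm _ -1ℤ ⟩
    -1ℤ ℤ.* ℤ∑.sumOver e (sgn ∘ f)          ≡⟨ ℤ.-1*i≡-i _ ⟩
    ℤ.- ℤ∑.sumOver e (sgn ∘ f)              ∎)
    where open ≡-Reasoning

-- The indicator of a pair of bits is a quarter of a product of two factors 1 ± sgn.
indicator-characters : ∀ a b x y → ℤ.+ 4 ℤ.* ℤ.+ [ (a ∷ b ∷ []) ≟ᵥ (x ∷ y ∷ []) ] ≡
  1ℤ ℤ.+ (sgn x ℤ.* sgn a ℤ.+ (sgn y ℤ.* sgn b ℤ.+ sgn (x ⊕ y) ℤ.* (sgn a ℤ.* sgn b)))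
indicator-characters 0F 0F 0F 0F = refl
indicator-characters 0F 0F 0F 1F = refl
indicator-characters 0F 0F 1F 0F = refl
indicator-characters 0F 0F 1F 1F = refl
indicator-characters 0F 1F 0F 0F = refl
indicator-characters 0F 1F 0F 1F = refl
indicator-characters 0F 1F 1F 0F = refl
indicator-characters 0F 1F 1F 1F = refl
indicator-characters 1F 0F 0F 0F = refl
indicator-characters 1F 0F 0F 1F = refl
indicator-characters 1F 0F 1F 0F = refl
indicator-characters 1F 0F 1F 1F = refl
indicator-characters 1F 1F 0F 0F = refl
indicator-characters 1F 1F 0F 1F = refl
indicator-characters 1F 1F 1F 0F = refl
indicator-characters 1F 1F 1F 1F = refl

∑ℤ-const-1 : ∀ n → ℤ∑.sum {n} (λ _ → 1ℤ) ≡ ℤ.+ n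
∑ℤ-const-1 n = trans (sym (+-∑ {n} (λ _ → 1))) (cong ℤ.+_ (∑-const-1 n))

-- In the character expansion of the indicator, the three nontrivial characters sum to zero and the
-- trivial one contributes `n`. The factor 4 on the left avoids division.
balanced-pair-count : ∀ {n} (f g : Fin n → Fin 2) → Balanced (↔-id _) f → Balanced (↔-id _) g →
  Balanced (↔-id _) (λ i → f i ⊕ g i) → ∀ v → 4 * ℕ∑.sum (λ i → [ v ≟ᵥ (f i ∷ g i ∷ []) ]) ≡ n
balanced-pair-count {n} f g f-bal g-bal fg-bal v@(a ∷ b ∷ []) = ℤ.+-injective (begin
  ℤ.+ (4 * ℕ∑.sum δ)                  ≡⟨ ℤ.pos-* 4 (ℕ∑.sum δ) ⟩
  ℤ.+ 4 ℤ.* ℤ.+ ℕ∑.sum δ              ≡⟨ cong (ℤ._*_ (ℤ.+ 4)) (+-∑ δ) ⟩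
  ℤ.+ 4 ℤ.* ℤ∑.sum (λ i → ℤ.+ δ i)    ≡⟨ ℤ∑.*-distribˡ-sum (ℤ.+ 4) (λ i → ℤ.+ δ i) ⟩
  ℤ∑.sum (λ i → ℤ.+ 4 ℤ.* ℤ.+ δ i)    ≡⟨ ℤ∑.sum-cong-≗ (λ i → indicator-characters a b (f i) (g i)) ⟩
  ℤ∑.sum (λ i → 1ℤ ℤ.+ (F i ℤ.+ (G i ℤ.+ FG i)))
    ≡⟨ ℤ∑.∑-distrib-+ (λ _ → 1ℤ) (λ i → F i ℤ.+ (G i ℤ.+ FG i)) ⟩
  ℤ∑.sum {n} (λ _ → 1ℤ) ℤ.+ ℤ∑.sum (λ i → F i ℤ.+ (G i ℤ.+ FG i))
    ≡⟨ cong₂ ℤ._+_ (∑ℤ-const-1 n) (∑-distrib-+-zero F _ (vanish f (sgn a) f-bal)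
         (∑-distrib-+-zero G FG (vanish g (sgn b) g-bal) (vanish (λ i → f i ⊕ g i) (sgn a ℤ.* sgn b) fg-bal))) ⟩
  ℤ.+ n ℤ.+ 0ℤ                        ≡⟨ ℤ.+-identityʳ (ℤ.+ n) ⟩
  ℤ.+ n                               ∎)
  where
  open ≡-Reasoning
  δ : Fin n → ℕ
  δ i = [ v ≟ᵥ (f i ∷ g i ∷ []) ]
  F G FG : Fin n → ℤ
  F  i = sgn (f i) ℤ.* sgn a
  G  i = sgn (g i) ℤ.* sgn b
  FG i = sgn (f i ⊕ g i) ℤ.* (sgn a ℤ.* sgn b)
  vanish : ∀ (h : Fin n → Fin 2) c → Balanced (↔-id _) h → ℤ∑.sum (λ i → sgn (h i) ℤ.* c) ≡ 0ℤ
  vanish h c bal = trans (sym (ℤ∑.*-distribʳ-sum c (sgn ∘ h))) (cong (ℤ._* c) bal)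
  ∑-distrib-+-zero : ∀ (P Q : Fin n → ℤ) → ℤ∑.sum P ≡ 0ℤ → ℤ∑.sum Q ≡ 0ℤ → ℤ∑.sum (λ i → P i ℤ.+ Q i) ≡ 0ℤ
  ∑-distrib-+-zero P Q P≡0 Q≡0 = trans (ℤ∑.∑-distrib-+ P Q) (cong₂ ℤ._+_ P≡0 Q≡0)

-- Strength 2 is a condition on pairs of columns, and on a pair the only nontrivial characters have
-- weight 1 or 2.
balanced⇒OA : ∀ {n k} {A : Set} (e : Fin n ↔ A) (row : A → Vec (Fin 2) k) → 2 ≤ k → 4 ∣ n →
  (∀ p → Balanced e (λ x → lookup (row x) p)) →
  (∀ {p q} → p ≢ q → Balanced e (λ x → lookup (row x) p ⊕ lookup (row x) q)) →
  IsOA n k 2 2 (row ∘ to e)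
balanced⇒OA {n} e row 2≤k 4∣n bal₁ bal₂ = record
  { 1≤q     = s≤s z≤n
  ; 1≤t     = s≤s z≤n
  ; t≤k     = 2≤k
  ; q^t∣n   = 4∣n
  ; uniform = λ c c-mono v → ℕ.*-cancelˡ-≡ _ _ 4 (begin
      4 * occurrences v (Vector.map (select c) (row ∘ to e))
        ≡⟨ cong (4 *_) (occurrences-∑ v (select c ∘ row ∘ to e)) ⟩
      4 * ℕ∑.sum (λ i → [ v ≟ᵥ select c (row (to e i)) ])
        -- An increasing `c` picks two distinct columns, so `bal₂` applies.
        ≡⟨ balanced-pair-count _ _ (bal₁ (c 0F)) (bal₁ (c 1F)) (bal₂ (Fin.<⇒≢ (c-mono {0F} {1F} (s≤s z≤n)))) v ⟩
      n
        ≡⟨ _∣_.equality 4∣n ⟩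
      quotient 4∣n * 4
        ≡⟨ ℕ.*-comm (quotient 4∣n) 4 ⟩
      4 * quotient 4∣n ∎) }
  where open ≡-Reasoning

-- Saturated arrays from Hadamard matrices

runs : ∀ α b → Fin (2 ^ α * b) ↔ (Vec (Fin 2) α × Fin b)
runs α b = ×-enum (vecEnum α) (↔-id (Fin b))

-- A normalised Hadamard matrix of order 2 ^ α * b whose columns (the runs) are
-- sorted by the values of α of its rows (the factors); those are then coordinates.
record SaturatedArray (α b : ℕ) : Set₁ where
  field
    Factor          : Set
    factors         : Fin (2 ^ α * b) ↔ Factor
    level           : Factor → Vec (Fin 2) α × Fin b → Fin 2
    const           : Factor
    coord           : Fin α → Factor
    level-const     : ∀ i → level const i ≡ 0F
    level-coord     : ∀ a i → level (coord a) i ≡ lookup (proj₁ i) a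
    coord-injective : Injective _≡_ _≡_ coord
    coord≢const     : ∀ a → coord a ≢ const
    orthogonal      : ∀ {s t} → s ≢ t → Balanced (runs α b) (λ i → level s i ⊕ level t i)

  -- Adding the all-zero factor `const` changes nothing, so this is orthogonality to `const`.
  balanced : ∀ {t} → t ≢ const → Balanced (runs α b) (level t)
  balanced {t} t≢const = balanced-cong (runs α b)
    (λ i → trans (cong (level t i ⊕_) (level-const i)) (⊕-identityʳ (level t i))) (orthogonal t≢const)

-- Sylvester's doubling.
double : ∀ {α b} → SaturatedArray α b → SaturatedArray (suc α) b
double {α} {b} S = record
  { Factor          = Fin 2 × S.Factor
  ; factors         = subst (λ n → Fin n ↔ (Fin 2 × S.Factor)) (sym (ℕ.*-assoc 2 (2 ^ α) b)) (×-enum (↔-id _) S.factors)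
  ; level           = level
  ; const           = 0F , S.const
  -- The new factor `(1F , S.const)` reads off the added bit; the old coordinates keep their level
  -- because `0F ⊙ x` vanishes.
  ; coord           = λ { zero → 1F , S.const ; (suc a) → 0F , S.coord a }
  ; level-const     = λ { (x ∷ s , β) → S.level-const (s , β) }
  ; level-coord     = λ { zero    (x ∷ s , β) → trans (cong (x ⊕_) (S.level-const (s , β))) (⊕-identityʳ x)
                        ; (suc a) (x ∷ s , β) → S.level-coord a (s , β) }
  ; coord-injective = λ { {zero}  {zero}   _  → refl
                        ; {suc a} {suc a′} eq → cong suc (S.coord-injective (cong proj₂ eq)) }
  ; coord≢const     = λ { zero () ; (suc a) eq → S.coord≢const a (cong proj₂ eq) }
  ; orthogonal      = orthogonal
  }
  where
  module S = SaturatedArray S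
  open ≡-Reasoning

  split : (Fin 2 × (Vec (Fin 2) α × Fin b)) ↔ (Vec (Fin 2) (suc α) × Fin b)
  split = mk↔ₛ′ (λ (x , (s , β)) → x ∷ s , β) (λ (s , β) → Vec.head s , (Vec.tail s , β))
    (λ { (x ∷ s , β) → refl }) (λ _ → refl)

  level : Fin 2 × S.Factor → Vec (Fin 2) (suc α) × Fin b → Fin 2
  level (ε , t) (x ∷ s , β) = (ε ⊙ x) ⊕ S.level t (s , β)

  orthogonal : ∀ {s t} → s ≢ t → Balanced (runs (suc α) b) (λ i → level s i ⊕ level t i)
  orthogonal {ε , t} {ε′ , t′} ne = begin
    ℤ∑.sumOver (runs (suc α) b) (λ i → sgn (level (ε , t) i ⊕ level (ε′ , t′) i))
      ≡⟨ ℤ∑.sumOver-reindex (×-enum (↔-id (Fin 2)) (runs α b)) (runs (suc α) b) split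
           (λ i → sgn (level (ε , t) i ⊕ level (ε′ , t′) i)) ⟨
    ℤ∑.sumOver (×-enum (↔-id (Fin 2)) (runs α b)) term
      ≡⟨ ℤ∑.sumOver-× (↔-id (Fin 2)) (runs α b) term ⟩
    ℤ∑.sum (λ x → ℤ∑.sumOver (runs α b) (λ i → term (x , i)))
      ≡⟨ ℤ∑.sum-cong-≗ inner ⟩
    ℤ∑.sum (λ x → sgn ((ε ⊙ x) ⊕ (ε′ ⊙ x)) ℤ.* total)
      ≡⟨ ℤ∑.*-distribʳ-sum total (λ x → sgn ((ε ⊙ x) ⊕ (ε′ ⊙ x))) ⟨
    ℤ∑.sum (λ x → sgn ((ε ⊙ x) ⊕ (ε′ ⊙ x))) ℤ.* total
      ≡⟨ vanish (from S.factors t Fin.≟ from S.factors t′) ⟩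
    0ℤ ∎
    where
    total : ℤ
    total = ℤ∑.sumOver (runs α b) (λ i → sgn (S.level t i ⊕ S.level t′ i))

    term : Fin 2 × (Vec (Fin 2) α × Fin b) → ℤ
    term (x , i) = sgn (((ε ⊙ x) ⊕ S.level t i) ⊕ ((ε′ ⊙ x) ⊕ S.level t′ i))

    -- Regrouping separates the added bit from the old run, so the sum over the doubled runs is a
    -- product of two character sums.
    inner : ∀ x → ℤ∑.sumOver (runs α b) (λ i → term (x , i)) ≡ sgn ((ε ⊙ x) ⊕ (ε′ ⊙ x)) ℤ.* total
    inner x = trans
      (ℤ∑.sumOver-cong (runs α b) λ i →
        trans (cong sgn (⊕-interchange (ε ⊙ x) (S.level t i) (ε′ ⊙ x) (S.level t′ i))) (sgn-⊕ ((ε ⊙ x) ⊕ (ε′ ⊙ x)) _))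
      (sym (ℤ∑.*-distribˡ-sum (sgn ((ε ⊙ x) ⊕ (ε′ ⊙ x))) (λ i → sgn (S.level t (to (runs α b) i) ⊕ S.level t′ (to (runs α b) i)))))

    character-sum : ∀ {ε ε′} → ε ≢ ε′ → ℤ∑.sum (λ x → sgn ((ε ⊙ x) ⊕ (ε′ ⊙ x))) ≡ 0ℤ
    character-sum {0F} {0F} ε≢ε′ = contradiction refl ε≢ε′
    character-sum {0F} {1F} _    = refl
    character-sum {1F} {0F} _    = refl
    character-sum {1F} {1F} ε≢ε′ = contradiction refl ε≢ε′

    -- Equal old factors force `ε ≢ ε′`, which kills the first sum; distinct ones make `total`
    -- vanish by orthogonality. `Factor` is an arbitrary type, so equality is decided on the indices
    -- given by `factors`.
    vanish : Dec (from S.factors t ≡ from S.factors t′) →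
             ℤ∑.sum (λ x → sgn ((ε ⊙ x) ⊕ (ε′ ⊙ x))) ℤ.* total ≡ 0ℤ
    vanish (yes eq) = cong (ℤ._* total) (character-sum λ ε≡ε′ → ne (cong₂ _,_ ε≡ε′
      (trans (sym (to-from S.factors t)) (trans (cong (to S.factors) eq) (to-from S.factors t′)))))
    vanish (no t≢t′) = trans (cong (X ℤ.*_) (S.orthogonal (t≢t′ ∘ cong (from S.factors)))) (ℤ.*-zeroʳ X)
      where
      X : ℤ
      X = ℤ∑.sum (λ x → sgn ((ε ⊙ x) ⊕ (ε′ ⊙ x)))

-- Base case: normalising and sorting a Hadamard matrix.

module FromHadamard {b} (1≤b : 1 ≤ b) {H : Matrix ℤ (4 * b) (4 * b)} (hadamard : IsHadamard (4 * b) H) where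
  open IsHadamard hadamard renaming (orthogonal to H-orthogonal)
  open ≡-Reasoning

  bit : ∀ {z} → z ≡ 1ℤ ⊎ z ≡ -1ℤ → Fin 2
  bit (inj₁ _) = 0F
  bit (inj₂ _) = 1F

  sgn-bit : ∀ {z} (±1 : z ≡ 1ℤ ⊎ z ≡ -1ℤ) → sgn (bit ±1) ≡ z
  sgn-bit (inj₁ z≡1)  = sym z≡1
  sgn-bit (inj₂ z≡-1) = sym z≡-1

  -- Row 0 becomes the constant factor, rows 1 and 2 the two coordinates; they exist because
  -- `4 ≤ 4 * b`.
  row : Fin 3 → Fin (4 * b)
  row r = Fin.inject≤ r (ℕ.≤-trans (s≤s (s≤s (s≤s z≤n))) (ℕ.*-monoʳ-≤ 4 1≤b))

  row-injective : ∀ {r r′} → row r ≡ row r′ → r ≡ r′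
  row-injective = Fin.inject≤-injective _ _ _ _

  -- Adding the bits of row 0 to every row multiplies each column by a sign, which turns row 0 into
  -- all ones.
  h normal : Fin (4 * b) → Fin (4 * b) → Fin 2
  h p i      = bit (entries p i)
  normal p i = h p i ⊕ h (row 0F) i

  normal-const : ∀ i → normal (row 0F) i ≡ 0F
  normal-const i = ⊕-self (h (row 0F) i)

  normal-orthogonal : ∀ {p q} → p ≢ q → Balanced (↔-id _) (λ i → normal p i ⊕ normal q i)
  normal-orthogonal {p} {q} p≢q = begin
    ℤ∑.sum (λ i → sgn (normal p i ⊕ normal q i)) ≡⟨ ℤ∑.sum-cong-≗ entry ⟩
    (H ⊡ Vector.transpose H) p q                 ≡⟨ H-orthogonal p q ⟩
    ℤ.+ (4 * b) ℤ.* identity (4 * b) p q         ≡⟨ cong (ℤ.+ (4 * b) ℤ.*_) (off-diagonal (p Fin.≟ q)) ⟩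
    ℤ.+ (4 * b) ℤ.* 0ℤ                           ≡⟨ ℤ.*-zeroʳ (ℤ.+ (4 * b)) ⟩
    0ℤ                                           ∎
    where
    off-diagonal : (d : Dec (p ≡ q)) → (if does d then 1ℤ else 0ℤ) ≡ 0ℤ
    off-diagonal (yes p≡q) = contradiction p≡q p≢q
    off-diagonal (no _)    = refl

    -- The sign coming from row 0 occurs twice and cancels, so normalising does not affect products
    -- of rows.
    entry : ∀ i → sgn (normal p i ⊕ normal q i) ≡ H p i ℤ.* H q i
    entry i = begin
      sgn (normal p i ⊕ normal q i)
        ≡⟨ cong sgn (⊕-interchange (h p i) _ (h q i) _) ⟩
      sgn ((h p i ⊕ h q i) ⊕ (h (row 0F) i ⊕ h (row 0F) i))
        ≡⟨ cong (λ z → sgn ((h p i ⊕ h q i) ⊕ z)) (⊕-self (h (row 0F) i)) ⟩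
      sgn ((h p i ⊕ h q i) ⊕ 0F)
        ≡⟨ cong sgn (⊕-identityʳ (h p i ⊕ h q i)) ⟩
      sgn (h p i ⊕ h q i)
        ≡⟨ sgn-⊕ (h p i) (h q i) ⟩
      sgn (h p i) ℤ.* sgn (h q i)
        ≡⟨ cong₂ ℤ._*_ (sgn-bit (entries p i)) (sgn-bit (entries q i)) ⟩
      H p i ℤ.* H q i ∎

  normal-balanced : ∀ {p} → p ≢ row 0F → Balanced (↔-id _) (normal p)
  normal-balanced {p} p≢0 = balanced-cong (↔-id _)
    (λ i → trans (cong (normal p i ⊕_) (normal-const i)) (⊕-identityʳ (normal p i))) (normal-orthogonal p≢0)

  coord : Fin 2 → Fin (4 * b)
  coord a = row (suc a)

  coord≢const : ∀ a → coord a ≢ row 0F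
  coord≢const a eq with () ← row-injective eq

  coords : Fin (4 * b) → Vec (Fin 2) 2
  coords i = normal (coord 0F) i ∷ normal (coord 1F) i ∷ []

  -- The two coordinate rows and their sum are balanced, so each pair of bits takes a quarter of the
  -- `4 * b` columns.
  coords-count : ∀ v → ℕ∑.sum (λ i → [ v ≟ᵥ coords i ]) ≡ b
  coords-count v = ℕ.*-cancelˡ-≡ _ b 4 (balanced-pair-count _ _ (normal-balanced (coord≢const 0F)) (normal-balanced (coord≢const 1F))
    (normal-orthogonal λ eq → contradiction (row-injective eq) λ ()) v)

  -- `coords` and the first component of `runs 2 b` both take every value exactly `b` times.
  sorting : Σ (Permutation (4 * b) (4 * b)) λ π → ∀ i → coords (π ⟨$⟩ʳ i) ≡ proj₁ (to (runs 2 b) i)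
  sorting = same-counts⇒permutation _≟ᵥ_ coords (proj₁ ∘ to (runs 2 b)) λ v → trans (coords-count v)
    (sym (count-fibres _≟ᵥ_ (vecEnum 2) (runs 2 b) (↔-id _) proj₁ (λ _ → refl) v))

  position : (Vec (Fin 2) 2 × Fin b) ↔ Fin (4 * b)
  position = proj₁ sorting ↔-∘ ↔-sym (runs 2 b)

  coords-position : ∀ i → coords (to position i) ≡ proj₁ i
  coords-position i = trans (proj₂ sorting (from (runs 2 b) i)) (cong proj₁ (to-from (runs 2 b) i))

  base : SaturatedArray 2 b
  base = record
    { Factor          = Fin (4 * b)
    ; factors         = ↔-id _
    ; level           = λ p → normal p ∘ to position
    ; const           = row 0F
    ; coord           = coord
    ; level-const     = normal-const ∘ to position
    ; level-coord     = λ { 0F i → cong (λ v → lookup v 0F) (coords-position i)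
                          ; 1F i → cong (λ v → lookup v 1F) (coords-position i) }
    ; coord-injective = Fin.suc-injective ∘ row-injective
    ; coord≢const     = coord≢const
    ; orthogonal      = λ {p} {q} p≢q → trans
        (ℤ∑.sumOver-reindex (runs 2 b) (↔-id _) position (λ i → sgn (normal p i ⊕ normal q i))) (normal-orthogonal p≢q)
    }

saturatedArray : ∀ {b} → 1 ≤ b → ∃ (IsHadamard (4 * b)) → ∀ γ → SaturatedArray (2 + γ) b
saturatedArray 1≤b (_ , hadamard) zero    = FromHadamard.base 1≤b hadamard
saturatedArray 1≤b hadamard       (suc γ) = double (saturatedArray 1≤b hadamard γ)

-- Extending injections

-- Pigeonhole: if `g` hit every index, choosing preimages would inject `Fin n` into the smaller
-- `Fin m`.
fresh : ∀ {m n} {T : Set} → Fin n ↔ T → (g : Fin m → T) → m < n → ∃ λ y → ∀ p → g p ≢ y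
fresh e g m<n with Fin.any? (λ y → Fin.all? (λ p → ¬? (from e (g p) Fin.≟ y)))
... | yes (y , y∉g) = to e y , λ p gp≡y → y∉g p (trans (cong (from e) gp≡y) (from-to e y))
... | no ¬fresh = contradiction collision (Fin.<⇒≢ (proj₁ (proj₂ (proj₂ pigeons))))
  where
  preimage : ∀ y → ∃ λ p → from e (g p) ≡ y
  preimage y with Fin.any? (λ p → from e (g p) Fin.≟ y)
  ... | yes hit = hit
  ... | no miss = contradiction (y , λ p eq → miss (p , eq)) ¬fresh

  pigeons : ∃₂ λ y y′ → y Fin.< y′ × proj₁ (preimage y) ≡ proj₁ (preimage y′)
  pigeons = Fin.pigeonhole m<n (proj₁ ∘ preimage)

  collision : proj₁ pigeons ≡ proj₁ (proj₂ pigeons)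
  collision = trans (sym (proj₂ (preimage _)))
    (trans (cong (from e ∘ g) (proj₂ (proj₂ (proj₂ pigeons)))) (proj₂ (preimage _)))

∷-injective : ∀ {n} {T : Set} {x} {g : Fin n → T} → Injective _≡_ _≡_ g → (∀ p → g p ≢ x) →
              Injective _≡_ _≡_ (x Vector.∷ g)
∷-injective inj g≢x {zero}  {zero}  _  = refl
∷-injective inj g≢x {zero}  {suc q} eq = contradiction (sym eq) (g≢x q)
∷-injective inj g≢x {suc p} {zero}  eq = contradiction eq (g≢x p)
∷-injective inj g≢x {suc p} {suc q} eq = cong suc (inj eq)

-- New values go in front, so the last `m` positions keep `g`; in the design these are the `α`
-- coordinates.
record Extension {m} {T : Set} (avoid : T) (g : Fin m → T) (k : ℕ) : Set where
  field
    extended  : Fin (k + m) → T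
    injective : Injective _≡_ _≡_ extended
    avoids    : ∀ p → extended p ≢ avoid
    extends   : ∀ a → extended (k ↑ʳ a) ≡ g a

extend : ∀ {m n} {T : Set} → Fin n ↔ T → (avoid : T) (g : Fin m → T) → Injective _≡_ _≡_ g → (∀ p → g p ≢ avoid) →
         ∀ k → k + m < n → Extension avoid g k
extend e avoid g inj g≢ zero    _    = record { extended = g ; injective = inj ; avoids = g≢ ; extends = λ _ → refl }
extend e avoid g inj g≢ (suc k) k+m<n with extend e avoid g inj g≢ k (ℕ.<⇒≤ k+m<n)
-- Together with `avoid` there are `suc (k + m)` values to miss, still fewer than `n`.
... | E with fresh e (avoid Vector.∷ Extension.extended E) k+m<n
... | y , y-fresh = record
  { extended  = y Vector.∷ E.extended
  ; injective = ∷-injective E.injective (y-fresh ∘ suc)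
  ; avoids    = λ { zero → y-fresh zero ∘ sym ; (suc p) → E.avoids p }
  ; extends   = E.extends
  }
  where module E = Extension E

-- Parity checks

-- Two kernel vectors through p with no other common position show that the
-- kernel has strength 2.
record ParityCheck (k α : ℕ) : Set where
  field
    syndrome      : Vec (Fin 2) k → Vec (Fin 2) α
    syndrome-⊞    : ∀ v w → syndrome (v ⊞ w) ≡ syndrome v ⊞ syndrome w
    surjective    : ∀ s → ∃ λ v → syndrome v ≡ s
    kernel        : Fin k → Fin 2 → Vec (Fin 2) k
    syndrome-0    : ∀ p ε → syndrome (kernel p ε) ≡ 𝟎
    kernel-hit    : ∀ p ε → lookup (kernel p ε) p ≡ 1F
    kernel-miss   : ∀ p {q} → q ≢ p → ∃ λ ε → lookup (kernel p ε) q ≡ 0F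

trivialParity : ∀ k → ParityCheck k 0
trivialParity k = record
  { syndrome    = λ _ → []
  ; syndrome-⊞  = λ _ _ → refl
  ; surjective  = λ { [] → 𝟎 , refl }
  ; kernel      = λ p _ → unit p
  ; syndrome-0  = λ _ _ → refl
  ; kernel-hit  = λ p _ → lookup-unit p
  ; kernel-miss = λ p q≢p → 0F , lookup-unit-≢ q≢p
  }

-- The new syndrome bit is the parity of three new positions. Each of these lies in two of the three
-- words of weight 2 on the triple, and those two meet nowhere else; old kernel vectors are padded
-- with zeros.
addParity : ∀ {k α} → ParityCheck k α → ParityCheck (3 + k) (suc α)
addParity {k} {α} P = record
  { syndrome    = syndrome
  ; syndrome-⊞  = λ { (x ∷ y ∷ z ∷ v) (x′ ∷ y′ ∷ z′ ∷ v′) → cong₂ _∷_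
      (trans (cong (_⊕ (z ⊕ z′)) (⊕-interchange x x′ y y′)) (⊕-interchange (x ⊕ y) (x′ ⊕ y′) z z′)) (P.syndrome-⊞ v v′) }
  ; surjective  = λ { (x ∷ s) → x ∷ 0F ∷ 0F ∷ proj₁ (P.surjective s) , cong₂ _∷_
      (trans (⊕-identityʳ (x ⊕ 0F)) (⊕-identityʳ x)) (proj₂ (P.surjective s)) }
  ; kernel      = kernel
  ; syndrome-0  = syndrome-0
  ; kernel-hit  = kernel-hit
  ; kernel-miss = kernel-miss
  }
  where
  module P = ParityCheck P

  syndrome : Vec (Fin 2) (3 + k) → Vec (Fin 2) (suc α)
  syndrome (x ∷ y ∷ z ∷ v) = x ⊕ y ⊕ z ∷ P.syndrome v

  kernel : Fin (3 + k) → Fin 2 → Vec (Fin 2) (3 + k)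
  kernel 0F                  0F = 1F ∷ 1F ∷ 0F ∷ 𝟎
  kernel 0F                  1F = 1F ∷ 0F ∷ 1F ∷ 𝟎
  kernel 1F                  0F = 1F ∷ 1F ∷ 0F ∷ 𝟎
  kernel 1F                  1F = 0F ∷ 1F ∷ 1F ∷ 𝟎
  kernel 2F                  0F = 1F ∷ 0F ∷ 1F ∷ 𝟎
  kernel 2F                  1F = 0F ∷ 1F ∷ 1F ∷ 𝟎
  kernel (suc (suc (suc p))) ε  = 0F ∷ 0F ∷ 0F ∷ P.kernel p ε

  -- Additivity makes `P.syndrome 𝟎` equal to its own double, and cancelling one copy leaves `𝟎`.
  P-syndrome-𝟎 : P.syndrome 𝟎 ≡ 𝟎
  P-syndrome-𝟎 = begin
    P.syndrome 𝟎                                 ≡⟨ ⊞-cancelʳ _ (P.syndrome 𝟎) ⟨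
    (P.syndrome 𝟎 ⊞ P.syndrome 𝟎) ⊞ P.syndrome 𝟎 ≡⟨ cong (_⊞ P.syndrome 𝟎) (P.syndrome-⊞ 𝟎 𝟎) ⟨
    P.syndrome (𝟎 ⊞ 𝟎) ⊞ P.syndrome 𝟎            ≡⟨ cong (λ v → P.syndrome v ⊞ P.syndrome 𝟎) (⊞-identityʳ 𝟎) ⟩
    P.syndrome 𝟎 ⊞ P.syndrome 𝟎                  ≡⟨ cong (_⊞ P.syndrome 𝟎) (⊞-identityʳ (P.syndrome 𝟎)) ⟨
    (P.syndrome 𝟎 ⊞ 𝟎) ⊞ P.syndrome 𝟎            ≡⟨ cong (_⊞ P.syndrome 𝟎) (⊞-comm (P.syndrome 𝟎) 𝟎) ⟩
    (𝟎 ⊞ P.syndrome 𝟎) ⊞ P.syndrome 𝟎            ≡⟨ ⊞-cancelʳ 𝟎 (P.syndrome 𝟎) ⟩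
    𝟎                                            ∎
    where open ≡-Reasoning

  syndrome-0 : ∀ p ε → syndrome (kernel p ε) ≡ 𝟎
  syndrome-0 0F                  0F = cong (0F ∷_) P-syndrome-𝟎
  syndrome-0 0F                  1F = cong (0F ∷_) P-syndrome-𝟎
  syndrome-0 1F                  0F = cong (0F ∷_) P-syndrome-𝟎
  syndrome-0 1F                  1F = cong (0F ∷_) P-syndrome-𝟎
  syndrome-0 2F                  0F = cong (0F ∷_) P-syndrome-𝟎
  syndrome-0 2F                  1F = cong (0F ∷_) P-syndrome-𝟎
  syndrome-0 (suc (suc (suc p))) ε  = cong (0F ∷_) (P.syndrome-0 p ε)

  kernel-hit : ∀ p ε → lookup (kernel p ε) p ≡ 1F
  kernel-hit 0F                  0F = refl
  kernel-hit 0F                  1F = refl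
  kernel-hit 1F                  0F = refl
  kernel-hit 1F                  1F = refl
  kernel-hit 2F                  0F = refl
  kernel-hit 2F                  1F = refl
  kernel-hit (suc (suc (suc p))) ε  = P.kernel-hit p ε

  kernel-miss : ∀ p {q} → q ≢ p → ∃ λ ε → lookup (kernel p ε) q ≡ 0F
  kernel-miss 0F                  {0F}                q≢p = contradiction refl q≢p
  kernel-miss 0F                  {1F}                _   = 1F , refl
  kernel-miss 0F                  {2F}                _   = 0F , refl
  kernel-miss 0F                  {suc (suc (suc q))} _   = 0F , lookup-𝟎 q
  kernel-miss 1F                  {0F}                _   = 1F , refl
  kernel-miss 1F                  {1F}                q≢p = contradiction refl q≢p
  kernel-miss 1F                  {2F}                _   = 0F , refl
  kernel-miss 1F                  {suc (suc (suc q))} _   = 0F , lookup-𝟎 q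
  kernel-miss 2F                  {0F}                _   = 1F , refl
  kernel-miss 2F                  {1F}                _   = 0F , refl
  kernel-miss 2F                  {2F}                q≢p = contradiction refl q≢p
  kernel-miss 2F                  {suc (suc (suc q))} _   = 0F , lookup-𝟎 q
  kernel-miss (suc (suc (suc p))) {0F}                _   = 0F , refl
  kernel-miss (suc (suc (suc p))) {1F}                _   = 0F , refl
  kernel-miss (suc (suc (suc p))) {2F}                _   = 0F , refl
  kernel-miss (suc (suc (suc p))) {suc (suc (suc q))} q≢p = P.kernel-miss p (q≢p ∘ cong (λ r → suc (suc (suc r))))

parityCheck : ∀ {k} α → α * 3 ≤ k → ParityCheck k α
parityCheck zero    _                     = trivialParity _
-- `suc α * 3` computes to `3 + α * 3`, so matching on the bound exposes three positions of `k` for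
-- the new triple.
parityCheck (suc α) (s≤s (s≤s (s≤s 3α≤k))) = addParity (parityCheck α 3α≤k)

-- The row-column design

-- A view: the first `k` positions are shifted by the column, the last `α` carry the sorting
-- coordinates.
data Position (k α : ℕ) : Fin (k + α) → Set where
  left  : ∀ p → Position k α (p ↑ˡ α)
  right : ∀ a → Position k α (k ↑ʳ a)

position : ∀ k {α} p → Position k α p
position k p with splitAt k p in eq
... | inj₁ p′ = subst (Position _ _) (Fin.splitAt⁻¹-↑ˡ eq) (left p′)
... | inj₂ a  = subst (Position _ _) (Fin.splitAt⁻¹-↑ʳ eq) (right a)

module Design {α b k} (S : SaturatedArray α b) (P : ParityCheck k α) (fits : k + α < 2 ^ α * b) where
  open SaturatedArray S
  open ParityCheck P
  open Extension (extend factors const coord coord-injective coord≢const k fits)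
  open ≡-Reasoning

  Run Shift Cell : Set
  Run   = Vec (Fin 2) α × Fin b
  Shift = Vec (Fin 2) k
  Cell  = Run × Shift

  run : Run → Vec (Fin 2) k
  run i = tabulate (λ p → level (extended (p ↑ˡ α)) i)

  moved : Cell → Run
  moved ((s , β) , j) = s ⊞ syndrome j , β

  cell : Cell → Vec (Fin 2) (k + α)
  cell c@(_ , j) = (run (moved c) ⊞ j) ++ proj₁ (moved c)

  entry : Fin (k + α) → Cell → Fin 2
  entry p c = lookup (cell c) p

  entry-left : ∀ p c → entry (p ↑ˡ α) c ≡ level (extended (p ↑ˡ α)) (moved c) ⊕ lookup (proj₂ c) p
  entry-left p c@(_ , j) = begin
    entry (p ↑ˡ α) c                                 ≡⟨ Vec.lookup-++ˡ (run (moved c) ⊞ j) _ p ⟩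
    lookup (run (moved c) ⊞ j) p                     ≡⟨ lookup-⊞ p (run (moved c)) j ⟩
    lookup (run (moved c)) p ⊕ lookup j p            ≡⟨ cong (_⊕ lookup j p) (Vec.lookup∘tabulate _ p) ⟩
    level (extended (p ↑ˡ α)) (moved c) ⊕ lookup j p ∎

  entry-right : ∀ a c → entry (k ↑ʳ a) c ≡ lookup (proj₁ (moved c)) a
  entry-right a c@(_ , j) = Vec.lookup-++ʳ (run (moved c) ⊞ j) _ a

  -- Padding with zeros lets both kinds of positions obey the single formula `entry-level`.
  offset : Shift → Fin (k + α) → Fin 2
  offset j = lookup (j ++ 𝟎)

  entry-level : ∀ p c → entry p c ≡ level (extended p) (moved c) ⊕ offset (proj₂ c) p
  entry-level p c@(_ , j) with position k p
  ... | left q  = trans (entry-left q c) (cong (level (extended (q ↑ˡ α)) (moved c) ⊕_) (sym (Vec.lookup-++ˡ j 𝟎 q)))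
  ... | right a = begin
    entry (k ↑ʳ a) c                           ≡⟨ entry-right a c ⟩
    lookup (proj₁ (moved c)) a                 ≡⟨ level-coord a (moved c) ⟨
    level (coord a) (moved c)                  ≡⟨ cong (λ t → level t (moved c)) (extends a) ⟨
    level t (moved c)                          ≡⟨ ⊕-identityʳ (level t (moved c)) ⟨
    level t (moved c) ⊕ 0F                     ≡⟨ cong (level t (moved c) ⊕_) (trans (Vec.lookup-++ʳ j 𝟎 a) (lookup-𝟎 a)) ⟨
    level t (moved c) ⊕ offset j (k ↑ʳ a)      ∎
    where
    t : Factor
    t = extended (k ↑ʳ a)

  -- Columns: permuted runs plus a constant.

  relocate : Shift → Run ↔ Run
  relocate j = ⊞-↔ (syndrome j) ×-↔ ↔-id (Fin b)

  column-balanced : ∀ j p → Balanced (runs α b) (λ i → entry p (i , j))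
  column-balanced j p = balanced-cong (runs α b) (λ i → sym (entry-level p (i , j)))
    (balanced-⊕ (runs α b) (L ∘ to (relocate j)) (offset j p)
      (balanced-reindex (runs α b) L (relocate j) (balanced (avoids p))))
    where
    L : Run → Fin 2
    L = level (extended p)

  column-balanced₂ : ∀ j {p q} → p ≢ q → Balanced (runs α b) (λ i → entry p (i , j) ⊕ entry q (i , j))
  column-balanced₂ j {p} {q} p≢q = balanced-cong (runs α b)
    (λ i → sym (trans (cong₂ _⊕_ (entry-level p (i , j)) (entry-level q (i , j)))
      (⊕-interchange (level (extended p) (moved (i , j))) (offset j p) (level (extended q) (moved (i , j))) (offset j q))))
    (balanced-⊕ (runs α b) (L ∘ to (relocate j)) (offset j p ⊕ offset j q)
      (balanced-reindex (runs α b) L (relocate j) (orthogonal (p≢q ∘ injective))))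
    where
    L : Run → Fin 2
    L i = level (extended p) i ⊕ level (extended q) i

  -- Rows: translations of the column index.

  Translates : Run → Shift → Fin (k + α) → Fin 2 → Set
  Translates i v p x = ∀ j → entry p (i , j ⊞ v) ≡ entry p (i , j) ⊕ x

  translate-right : ∀ i v a → Translates i v (k ↑ʳ a) (lookup (syndrome v) a)
  translate-right i@(s , β) v a j = begin
    entry (k ↑ʳ a) (i , j ⊞ v)                           ≡⟨ entry-right a (i , j ⊞ v) ⟩
    lookup (s ⊞ syndrome (j ⊞ v)) a                      ≡⟨ cong (λ w → lookup (s ⊞ w) a) (syndrome-⊞ j v) ⟩
    lookup (s ⊞ (syndrome j ⊞ syndrome v)) a             ≡⟨ cong (λ w → lookup w a) (⊞-assoc s _ _) ⟨
    lookup ((s ⊞ syndrome j) ⊞ syndrome v) a             ≡⟨ lookup-⊞ a (s ⊞ syndrome j) _ ⟩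
    lookup (s ⊞ syndrome j) a ⊕ lookup (syndrome v) a    ≡⟨ cong (_⊕ lookup (syndrome v) a) (entry-right a (i , j)) ⟨
    entry (k ↑ʳ a) (i , j) ⊕ lookup (syndrome v) a       ∎

  -- Since `v` lies in the kernel, the run stays in place and only the added shift changes the
  -- entry.
  translate-left : ∀ i v p → syndrome v ≡ 𝟎 → Translates i v (p ↑ˡ α) (lookup v p)
  translate-left i@(s , β) v p v∈ker j = begin
    entry (p ↑ˡ α) (i , j ⊞ v)
      ≡⟨ entry-left p (i , j ⊞ v) ⟩
    level (extended (p ↑ˡ α)) (moved (i , j ⊞ v)) ⊕ lookup (j ⊞ v) p
      ≡⟨ cong₂ (λ t x → level (extended (p ↑ˡ α)) (s ⊞ t , β) ⊕ x) same (lookup-⊞ p j v) ⟩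
    level (extended (p ↑ˡ α)) (moved (i , j)) ⊕ (lookup j p ⊕ lookup v p)
      ≡⟨ ⊕-assoc (level (extended (p ↑ˡ α)) (moved (i , j))) (lookup j p) (lookup v p) ⟨
    (level (extended (p ↑ˡ α)) (moved (i , j)) ⊕ lookup j p) ⊕ lookup v p
      ≡⟨ cong (_⊕ lookup v p) (entry-left p (i , j)) ⟨
    entry (p ↑ˡ α) (i , j) ⊕ lookup v p ∎
    where
    same : syndrome (j ⊞ v) ≡ syndrome j
    same = trans (syndrome-⊞ j v) (trans (cong (syndrome j ⊞_) v∈ker) (⊞-identityʳ _))

  kernel-translates : ∀ i p ε q → Translates i (kernel p ε) (q ↑ˡ α) (lookup (kernel p ε) q)
  kernel-translates i p ε q = translate-left i (kernel p ε) q (syndrome-0 p ε)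

  kernel-flips : ∀ i p ε → Translates i (kernel p ε) (p ↑ˡ α) 1F
  kernel-flips i p ε = subst (Translates i (kernel p ε) (p ↑ˡ α)) (kernel-hit p ε) (kernel-translates i p ε p)

  kernel-fixes : ∀ i p ε a → Translates i (kernel p ε) (k ↑ʳ a) 0F
  kernel-fixes i p ε a = subst (Translates i (kernel p ε) (k ↑ʳ a))
    (trans (cong (λ w → lookup w a) (syndrome-0 p ε)) (lookup-𝟎 a)) (translate-right i (kernel p ε) a)

  -- Among the last `α` positions this shift changes only `a`. Its effect on the first `k` is not
  -- controlled, so it is used only for positions on the right.
  lift : Fin α → Shift
  lift a = proj₁ (surjective (unit a))

  lift-translates : ∀ i a a′ → Translates i (lift a) (k ↑ʳ a′) (lookup (unit a) a′)
  lift-translates i a a′ = subst (λ w → Translates i (lift a) (k ↑ʳ a′) (lookup w a′))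
    (proj₂ (surjective (unit a))) (translate-right i (lift a) a′)

  lift-flips : ∀ i a → Translates i (lift a) (k ↑ʳ a) 1F
  lift-flips i a = subst (Translates i (lift a) (k ↑ʳ a)) (lookup-unit a) (lift-translates i a a)

  lift-fixes : ∀ i a {a′} → a′ ≢ a → Translates i (lift a) (k ↑ʳ a′) 0F
  lift-fixes i a a′≢a = subst (Translates i (lift a) _) (lookup-unit-≢ a′≢a) (lift-translates i a _)

  flipped : ∀ i p → ∃ λ v → Translates i v p 1F
  flipped i p with position k p
  ... | left p′ = kernel p′ 0F , kernel-flips i p′ 0F
  ... | right a = lift a , lift-flips i a

  -- Increments `x` and `1F ⊕ x` mean that exactly one of the two entries flips, hence so does their
  -- sum. A kernel vector serves unless both positions are on the right; for two left positions it
  -- must miss `q`.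
  separated : ∀ i {p q} → p ≢ q → ∃₂ λ v x → Translates i v p x × Translates i v q (1F ⊕ x)
  separated i {p} {q} p≢q with position k p | position k q
  ... | left p′ | left q′ = kernel p′ ε , 1F , kernel-flips i p′ ε ,
    subst (Translates i (kernel p′ ε) (q′ ↑ˡ α)) (proj₂ missing) (kernel-translates i p′ ε q′)
    where
    missing : ∃ λ ε → lookup (kernel p′ ε) q′ ≡ 0F
    missing = kernel-miss p′ (p≢q ∘ cong (_↑ˡ α) ∘ sym)
    ε : Fin 2
    ε = proj₁ missing
  ... | left p′ | right a  = kernel p′ 0F , 1F , kernel-flips i p′ 0F , kernel-fixes i p′ 0F a
  ... | right a | left q′  = kernel q′ 0F , 0F , kernel-fixes i q′ 0F a , kernel-flips i q′ 0F
  ... | right a | right a′ = lift a , 1F , lift-flips i a , lift-fixes i a (p≢q ∘ cong (k ↑ʳ_) ∘ sym)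

  row-balanced : ∀ i p → Balanced (vecEnum k) (λ j → entry p (i , j))
  row-balanced i p = balanced-flip (vecEnum k) (λ j → entry p (i , j)) (⊞-↔ (proj₁ (flipped i p))) (proj₂ (flipped i p))

  row-balanced₂ : ∀ i {p q} → p ≢ q → Balanced (vecEnum k) (λ j → entry p (i , j) ⊕ entry q (i , j))
  row-balanced₂ i {p} {q} p≢q with separated i p≢q
  ... | v , x , p-moves , q-moves = balanced-flip (vecEnum k) (λ j → entry p (i , j) ⊕ entry q (i , j)) (⊞-↔ v) λ j → begin
    entry p (i , j ⊞ v) ⊕ entry q (i , j ⊞ v)
      ≡⟨ cong₂ _⊕_ (p-moves j) (q-moves j) ⟩
    (entry p (i , j) ⊕ x) ⊕ (entry q (i , j) ⊕ (1F ⊕ x))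
      ≡⟨ ⊕-interchange (entry p (i , j)) x (entry q (i , j)) (1F ⊕ x) ⟩
    (entry p (i , j) ⊕ entry q (i , j)) ⊕ (x ⊕ (1F ⊕ x))
      ≡⟨ cong ((entry p (i , j) ⊕ entry q (i , j)) ⊕_) (trans (⊕-comm x (1F ⊕ x)) (⊕-cancelʳ 1F x)) ⟩
    (entry p (i , j) ⊕ entry q (i , j)) ⊕ 1F ∎

  -- Replication: each vector lies in `b` cells.

  cells : (Vec (Fin 2) (k + α) × Fin b) ↔ Cell
  cells = mk↔ₛ′ locate (λ c → cell c , proj₂ (proj₁ c)) locate-cell cell-locate
    where
    -- The last part `w` is the moved index, so it fixes the run; adding the run to `v` recovers the
    -- column, and adding the column's syndrome to `w` recovers the row.
    decode : Vec (Fin 2) k → Vec (Fin 2) α → Fin b → Cell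
    decode v w β = (w ⊞ syndrome (run (w , β) ⊞ v) , β) , run (w , β) ⊞ v

    locate : Vec (Fin 2) (k + α) × Fin b → Cell
    locate (v , β) = decode (take k v) (drop k v) β

    locate-cell : ∀ c → locate (cell c , proj₂ (proj₁ c)) ≡ c
    locate-cell c@((s , β) , j) = begin
      decode (take k (cell c)) (drop k (cell c)) β
        ≡⟨ cong (λ (v , w) → decode v w β) (from-to (++-↔ k) (run (moved c) ⊞ j , s ⊞ syndrome j)) ⟩
      decode (run (moved c) ⊞ j) (s ⊞ syndrome j) β
        ≡⟨ cong (λ j′ → ((s ⊞ syndrome j) ⊞ syndrome j′ , β) , j′) (⊞-cancelˡ (run (moved c)) j) ⟩
      (((s ⊞ syndrome j) ⊞ syndrome j , β) , j)
        ≡⟨ cong (λ s′ → (s′ , β) , j) (⊞-cancelʳ s (syndrome j)) ⟩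
      c ∎

    cell-decode : ∀ v w β → cell (decode v w β) ≡ v ++ w
    cell-decode v w β = begin
      cell (decode v w β)
        ≡⟨ cong (λ s → (run (s , β) ⊞ (run (w , β) ⊞ v)) ++ s) (⊞-cancelʳ w _) ⟩
      (run (w , β) ⊞ (run (w , β) ⊞ v)) ++ w
        ≡⟨ cong (_++ w) (⊞-cancelˡ (run (w , β)) v) ⟩
      v ++ w ∎

    cell-locate : ∀ x → (cell (locate x) , proj₂ x) ≡ x
    cell-locate (v , β) = cong (_, β) (trans (cell-decode (take k v) (drop k v) β) (Vec.take++drop≡id k v))

  design : Matrix (Vec (Fin 2) (k + α)) (2 ^ α * b) (2 ^ k)
  design r c = cell (to (runs α b) r , to (vecEnum k) c)

  design-replicated : ∀ v → occurrences v (Vector.concat design) ≡ b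
  design-replicated v = trans (occurrences-∑ v (Vector.concat design))
    -- `×-enum` splits an index into row and column as `Vector.concat` does, so the two sums agree
    -- by computation.
    (count-fibres _≟ᵥ_ (vecEnum (k + α)) (×-enum (runs α b) (vecEnum k)) cells cell
      (λ x → cong proj₁ (from-to cells x)) v)

  isTypeI : 2 ≤ k → 2 ≤ α → IsTypeI (k + α) (2 ^ α * b) (2 ^ k) 2 2 design
  isTypeI 2≤k 2≤α = record
    { q^k∣mn     = divides b (begin
        2 ^ α * b * 2 ^ k   ≡⟨ cong (_* 2 ^ k) (ℕ.*-comm (2 ^ α) b) ⟩
        b * 2 ^ α * 2 ^ k   ≡⟨ ℕ.*-assoc b (2 ^ α) (2 ^ k) ⟩
        b * (2 ^ α * 2 ^ k) ≡⟨ cong (b *_) (ℕ.*-comm (2 ^ α) (2 ^ k)) ⟩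
        b * (2 ^ k * 2 ^ α) ≡⟨ cong (b *_) (ℕ.^-distribˡ-+-* 2 k α) ⟨
        b * 2 ^ (k + α)     ∎)
    ; replicated = design-replicated
    ; rowOA      = λ r → let i = to (runs α b) r in
        balanced⇒OA (vecEnum k) (λ j → cell (i , j)) 2≤k+α (4∣2^ 2≤k) (row-balanced i) (row-balanced₂ i)
    ; columnOA   = λ c → let j = to (vecEnum k) c in
        balanced⇒OA (runs α b) (λ i → cell (i , j)) 2≤k+α (∣m⇒∣m*n b (4∣2^ 2≤α)) (column-balanced j) (column-balanced₂ j)
    }
    where
    2≤k+α : 2 ≤ k + α
    2≤k+α = ℕ.≤-trans 2≤k (ℕ.m≤m+n k α)

    4∣2^ : ∀ {n} → 2 ≤ n → 4 ∣ 2 ^ n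
    4∣2^ {suc (suc n)} (s≤s (s≤s z≤n)) = divides (2 ^ n) (trans (sym (ℕ.*-assoc 2 2 (2 ^ n))) (ℕ.*-comm 4 (2 ^ n)))

-- Numerical bounds and the conclusion.

γ+2≤2^[γ+1] : ∀ γ → 2 + γ ≤ 2 ^ suc γ
γ+2≤2^[γ+1] zero    = ℕ.≤-refl
γ+2≤2^[γ+1] (suc γ) = begin
  3 + γ                       ≤⟨ ℕ.+-mono-≤ (ℕ.m^n>0 2 (suc γ)) (γ+2≤2^[γ+1] γ) ⟩
  2 ^ suc γ + 2 ^ suc γ       ≡⟨ cong (2 ^ suc γ +_) (ℕ.+-identityʳ (2 ^ suc γ)) ⟨
  2 ^ suc (suc γ)             ∎
  where open ℕ.≤-Reasoning

theorem7 : (b : ℕ) → 1 ≤ b → ∃ (IsHadamard (4 * b)) →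
    (α k : ℕ) → 2 ≤ α → 2 ^ α + α + 1 ≤ k → k < 2 ^ α * b ∸ α →
    ∃ (IsTypeI (k + α) (2 ^ α * b) (2 ^ k) 2 2)
theorem7 b 1≤b hadamard α@(suc (suc γ)) k 2≤α@(s≤s (s≤s z≤n)) k-lower k-upper =
  _ , Design.isTypeI (saturatedArray 1≤b hadamard γ) (parityCheck α 3α≤k) fits
        (ℕ.≤-trans 2≤α (ℕ.≤-trans (ℕ.m≤m*n α 3) 3α≤k)) 2≤α
  where
  3α≤k : α * 3 ≤ k
  3α≤k = begin
    α * 3               ≡⟨ ℕ.*-comm α 3 ⟩
    -- Using `α ≤ 2 ^ suc γ` twice bounds `α + α` by `2 ^ α`.
    α + (α + (α + 0))   ≤⟨ ℕ.+-mono-≤ (γ+2≤2^[γ+1] γ) (ℕ.+-mono-≤ (γ+2≤2^[γ+1] γ) (ℕ.≤-reflexive (ℕ.+-identityʳ α))) ⟩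
    2 ^ suc γ + (2 ^ suc γ + α) ≡⟨ ℕ.+-assoc (2 ^ suc γ) _ α ⟨
    2 ^ suc γ + 2 ^ suc γ + α   ≡⟨ cong (λ n → 2 ^ suc γ + n + α) (ℕ.+-identityʳ (2 ^ suc γ)) ⟨
    2 ^ α + α           ≤⟨ ℕ.m≤m+n (2 ^ α + α) 1 ⟩
    2 ^ α + α + 1       ≤⟨ k-lower ⟩
    k                   ∎
    where open ℕ.≤-Reasoning

  fits : k + α < 2 ^ α * b
  fits = ℕ.m≤o∸n⇒m+n≤o (suc k) α≤2^αb k-upper
    where
    α≤2^αb : α ≤ 2 ^ α * b
    -- A truncated difference of zero would contradict `k-upper`, so the subtraction is exact.
    α≤2^αb = ℕ.<⇒≤ (ℕ.m∸n≢0⇒n<m λ eq → contradiction (subst (k <_) eq k-upper) λ ())
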